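{- $$\operatorname{gr}_4(P_5:PA_{6,5})=24 .$$
   Context: All graphs are finite, simple and undirected. $K_n$ is the complete graph on $n$ vertices and $P_5$ is the path with $5$ vertices and $4$ edges. For $t\geq\omega+1$, the pineapple $PA_{t,\omega}$ is the graph of order $t$ obtained from the complete graph $K_\omega$ by attaching $t-\omega$ pendent vertices to one and the same vertex of $K_\omega$; thus $PA_{6,5}$ is $K_5$ with one pendent vertex attached. A $k$-edge-coloring assigns to each edge one of $k$ colors; all $k$-edge-colorings are assumed exact, i.e. each of the $k$ colors is used at least once. An edge-colored graph is rainbow if all its edges have different colors and monochromatic if all its edges have a single color. A copy of a graph means a (not necessarily induced) subgraph isomorphic to it. For non-empty graphs $G,H$ (graphs with at least one edge) and a positive integer $k$, the Gallai-Ramsey number $\operatorname{gr}_k(G:H)$ is the minimum integer $N$ with $\binom{N}{2}\geq k$ (so that $K_N$ admits a $k$-edge-coloring) such that for all $n\geq N$, every $k$-edge-coloring of $K_n$ contains either a rainbow copy of $G$ or a monochromatic copy of $H$. -}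

module Defs where

open import Data.Fin using (Fin; toℕ)
open import Data.Fin.Properties using () renaming (_≟_ to _≟ᶠ_)
open import Data.Nat using (ℕ; suc; _≤_; _<_; NonZero)
open import Data.Nat.Combinatorics using (_C_)
open import Data.Nat.Properties using (_≟_; _≤?_; _<?_)
open import Data.Product using (Σ; ∃-syntax; _×_; _,_)
open import Data.Sum using (_⊎_; inj₁; inj₂; swap)
open import Function.Definitions using (Injective)
open import Relation.Binary.Definitions using (Decidable; Symmetric)
open import Relation.Binary.PropositionalEquality using (_≡_; _≢_; refl; sym)
open import Relation.Nullary using (¬_)
open import Relation.Nullary.Decidable using (¬?; _×-dec_; _⊎-dec_)

record Graph : Set₁ where
  field
    order      : ℕ
    Adj        : Fin order → Fin order → Set
    adj-sym    : Symmetric Adj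
    adj-irrefl : ∀ {u} → ¬ Adj u u
    adj?       : Decidable Adj

  Vertex : Set
  Vertex = Fin order

open Graph public

K : ℕ → Graph
K n = record
  { order      = n
  ; Adj        = _≢_
  ; adj-sym    = λ u≢v v≡u → u≢v (sym v≡u)
  ; adj-irrefl = λ u≢u → u≢u refl
  ; adj?       = λ u v → ¬? (u ≟ᶠ v)
  }

-- The path with n vertices.
P : ℕ → Graph
P n = record
  { order      = n
  ; Adj        = λ u v → suc (toℕ u) ≡ toℕ v ⊎ suc (toℕ v) ≡ toℕ u
  ; adj-sym    = swap
  ; adj-irrefl = λ { (inj₁ p) → suc≢ p ; (inj₂ p) → suc≢ p }
  ; adj?       = λ u v → (suc (toℕ u) ≟ toℕ v) ⊎-dec (suc (toℕ v) ≟ toℕ u)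
  }
  where
  suc≢ : ∀ {m} → suc m ≢ m
  suc≢ ()

-- The pineapple with clique vertices 0, …, ω-1 and pendent vertices
-- ω, …, t-1, all attached to the clique vertex 0.
PA : (t ω : ℕ) .{{_ : NonZero ω}} → .(ω < t) → Graph
PA t ω@(suc _) _ = record
  { order      = t
  ; Adj        = λ u v → Clique u v ⊎ (Pendent u v ⊎ Pendent v u)
  ; adj-sym    = λ { (inj₁ (u≢v , u<ω , v<ω)) →
                       inj₁ ((λ v≡u → u≢v (sym v≡u)) , v<ω , u<ω)
                   ; (inj₂ p) → inj₂ (swap p) }
  ; adj-irrefl = λ { (inj₁ (u≢u , _)) → u≢u refl
                   ; (inj₂ (inj₁ p)) → noLoop p
                   ; (inj₂ (inj₂ p)) → noLoop p }
  ; adj?       = λ u v → clique? u v ⊎-dec (pendent? u v ⊎-dec pendent? v u)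
  }
  where
  Clique Pendent : Fin t → Fin t → Set
  Clique  u v = u ≢ v × toℕ u < ω × toℕ v < ω
  Pendent u v = toℕ u ≡ 0 × ω ≤ toℕ v

  clique? : Decidable Clique
  clique? u v = ¬? (u ≟ᶠ v) ×-dec ((toℕ u <? ω) ×-dec (toℕ v <? ω))

  pendent? : Decidable Pendent
  pendent? u v = (toℕ u ≟ 0) ×-dec (ω ≤? toℕ v)

  noLoop : ∀ {u} → ¬ Pendent u u
  noLoop {u} (p , q) with toℕ u
  noLoop (refl , ()) | .0

-- An exact k-edge-coloring.  Edges are presented as ordered pairs of adjacent
-- vertices; the irrelevant adjacency proof cannot influence the color.
record EdgeColoring (k : ℕ) (G : Graph) : Set where
  field
    color     : (u v : Vertex G) → .(Adj G u v) → Fin k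
    color-sym : ∀ u v (e : Adj G u v) → color u v e ≡ color v u (adj-sym G e)
    exact     : ∀ c → ∃[ u ] ∃[ v ] Σ (Adj G u v) λ e → color u v e ≡ c

open EdgeColoring public

-- A not necessarily induced subgraph of G isomorphic to H.
record Copy (H G : Graph) : Set where
  field
    vertex    : Vertex H → Vertex G
    injective : Injective _≡_ _≡_ vertex
    edge      : ∀ {u v} → Adj H u v → Adj G (vertex u) (vertex v)

open Copy public

module _ {k : ℕ} {G H : Graph} (χ : EdgeColoring k G) (f : Copy H G) where

  copyColor : ∀ {u v} → Adj H u v → Fin k
  copyColor {u} {v} e = color χ (vertex f u) (vertex f v) (edge f e)

  Monochromatic : Set
  Monochromatic = ∃[ c ] (∀ {u v} (e : Adj H u v) → copyColor e ≡ c)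

  -- Edges of the same color are equal as unordered pairs.
  Rainbow : Set
  Rainbow = ∀ {u v x y} (e : Adj H u v) (e′ : Adj H x y) →
            copyColor e ≡ copyColor e′ → (u ≡ x × v ≡ y) ⊎ (u ≡ y × v ≡ x)

record GallaiRamseyBound (k : ℕ) (G H : Graph) (N : ℕ) : Set where
  field
    colorable   : k ≤ N C 2
    unavoidable : ∀ n → N ≤ n → (χ : EdgeColoring k (K n)) →
                  (Σ (Copy G (K n)) (Rainbow χ)) ⊎
                  (Σ (Copy H (K n)) (Monochromatic χ))

-- gr k ⟨ G ∶ H ⟩≡ N says that N is the Gallai-Ramsey number gr_k(G : H).
gr_⟨_∶_⟩≡_ : (k : ℕ) .{{_ : NonZero k}} → Graph → Graph → ℕ → Set
gr k ⟨ G ∶ H ⟩≡ N =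
  GallaiRamseyBound k G H N × (∀ M → GallaiRamseyBound k G H M → N ≤ M)

{-# OPTIONS --safe #-}
module Submission where

open import Defs
open import Algebra.Properties.CommutativeSemigroup using (interchange)
open import Data.Bool using (Bool; true; false; T; not; _∧_; _∨_; if_then_else_)
open import Data.Bool.ListAction using (any; all)
open import Data.Bool.Properties using (T-∧; T-∨)
open import Data.Empty using (⊥; ⊥-elim)
open import Data.Fin using (Fin; zero; suc; toℕ; fromℕ<; inject₁; punchIn; #_)
open import Data.Fin.Properties
  using (all?; any?; injective⇒≤; toℕ-injective; toℕ-inject₁; toℕ-fromℕ<; toℕ<n;
         inject₁-injective; punchIn-injective; punchInᵢ≢i)
  renaming (_≟_ to _≟ᶠ_)
open import Data.List
  using (List; []; _∷_; _++_; map; lookup; length; filter; filterᵇ; take; allFin)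
import Data.List.Membership.DecPropositional as DecMembership
open import Data.List.Membership.Propositional using (_∈_; _∉_; find)
open import Data.List.Membership.Propositional.Properties
  using (∈-allFin; ∈-lookup; ∈-filter⁻; ∈-filter⁺; ∈-++⁻)
open import Data.List.Properties
  using (filter-all; filter-reject; length-take; length-tabulate; length-++)
import Data.List.Relation.Binary.Sublist.Propositional as Sublist
open import Data.List.Relation.Binary.Sublist.Propositional.Properties using (take-⊆)
open import Data.List.Relation.Binary.Subset.Propositional using (_⊆_)
open import Data.List.Relation.Binary.Subset.Propositional.Properties using (filter-⊆)
open import Data.List.Relation.Unary.All as All using (All; []; _∷_)
import Data.List.Relation.Unary.All.Properties as All
open import Data.List.Relation.Unary.AllPairs as AllPairs using (AllPairs; []; _∷_; allPairs?)
import Data.List.Relation.Unary.AllPairs.Properties as AllPairs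
open import Data.List.Relation.Unary.Any as Any using (here; there; index)
open import Data.List.Relation.Unary.Any.Properties using (any⁻; lookup-index)
open import Data.List.Relation.Unary.Unique.Propositional using (Unique)
import Data.List.Relation.Unary.Unique.Propositional.Properties as Unique
open import Data.Nat
open import Data.Nat.Combinatorics using (_C_)
open import Data.Nat.Divisibility using (_∣_; _∣?_; ∣m∣n⇒∣m+n; divides)
open import Data.Nat.ListAction using (sum)
open import Data.Nat.Properties
open import Data.Product using (Σ; _×_; _,_; ∃-syntax; proj₁; proj₂)
open import Data.Sum as Sum using (_⊎_; inj₁; inj₂; [_,_]′)
open import Data.Vec as Vec using (Vec; updateAt)
open import Data.Vec.Properties using (lookup∘updateAt; lookup∘updateAt′; lookup-replicate)
open import Function using (_∘_; id)
open import Function.Bundles using (Equivalence)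
open import Function.Definitions using (Injective)
open import Relation.Binary.Definitions using (Symmetric; Decidable; tri<; tri≈; tri>)
open import Relation.Binary.PropositionalEquality hiding ([_])
open import Relation.Nullary using (¬_; Dec; yes; no)
open import Relation.Nullary.Decidable
  using (toWitness; from-no; toSum; T?; ¬?; _→-dec_; _×-dec_)
import Relation.Unary as U
open import Relation.Unary.Properties using (_∪?_; ∁?)

-- Upper bound.  If some vertex x sees three colours along xa, xb, xc, and yz is
-- an edge of the fourth colour, then a finite search shows that without a
-- rainbow P₅ all edges avoiding {x, a, b, c, y, z} have one colour, which gives
-- a monochromatic K₆.  Otherwise the vertices have pairwise intersecting sets
-- of at most two colours; as four colours occur, these sets share a colour d,
-- and the vertices split into one class for each other colour t, with colour d
-- between the classes and colours d, t inside them.  A class with at least 6 (resp. 14) vertices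
-- contains a d-coloured K₂ (resp. K₃, by R(3,5) ≤ 14); as there is no K₅ of
-- colour d with a pendent edge, there are at most 13 + 5 + 5 vertices.
--
-- Lower bound.  Take the classes C₁₃(1, 5), K₅ and K₅.

-- Exhaustive search for rainbow paths

Colour : Set
Colour = Fin 4

RainbowPath : ∀ {n} → (Fin n → Fin n → Colour) → Set
RainbowPath col = ∃[ v₁ ] ∃[ v₂ ] ∃[ v₃ ] ∃[ v₄ ] ∃[ v₅ ]
  Unique (v₁ ∷ v₂ ∷ v₃ ∷ v₄ ∷ v₅ ∷ []) ×
  Unique (col v₁ v₂ ∷ col v₂ v₃ ∷ col v₃ v₄ ∷ col v₄ v₅ ∷ [])

All-lookup : ∀ {A : Set} {P : A → Set} {xs} → All P xs → ∀ i → P (lookup xs i)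
All-lookup pxs i = All.lookup pxs (∈-lookup i)

AllPairs-lookup : ∀ {A : Set} {R : A → A → Set} → Symmetric R → ∀ {xs} → AllPairs R xs →
                  ∀ {i j} → i ≢ j → R (lookup xs i) (lookup xs j)
AllPairs-lookup sy (r ∷ rs) {zero}  {zero}  i≢j = ⊥-elim (i≢j refl)
AllPairs-lookup sy (r ∷ rs) {zero}  {suc j} i≢j = All-lookup r j
AllPairs-lookup sy (r ∷ rs) {suc i} {zero}  i≢j = sy (All-lookup r i)
AllPairs-lookup sy (r ∷ rs) {suc i} {suc j} i≢j = AllPairs-lookup sy rs (i≢j ∘ cong suc)

Unique-lookup : ∀ {A : Set} {xs : List A} → Unique xs → Injective _≡_ _≡_ (lookup xs)
Unique-lookup uniq {i} {j} eq with i ≟ᶠ j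
... | yes i≡j = i≡j
... | no  i≢j = ⊥-elim (AllPairs-lookup (_∘ sym) uniq i≢j eq)

-- Adjacency lists of a partially coloured graph on Fin m.
PartialColouring : ℕ → Set
PartialColouring m = Vec (List (Fin m × Colour)) m

infixr 5 _▹_
_▹_ : ∀ {m} → Fin m × Fin m × Colour → PartialColouring m → PartialColouring m
(p , q , c) ▹ α = updateAt (updateAt α p ((q , c) ∷_)) q ((p , c) ∷_)

infix 4 _==_
-- A Boolean test instead of `_≟ᶠ_`, so that the search carries no proof terms when it is evaluated.
_==_ : ∀ {m} → Fin m → Fin m → Bool
i == j = toℕ i ≡ᵇ toℕ j

fresh : ∀ {m} → Fin m → List (Fin m) → Bool
fresh x = all (λ y → not (x == y))

-- `k` counts the edges still to be added to a path that ends at `u`, with earlier vertices `us` and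
-- used colours `cs`.
trail : ∀ {m} → PartialColouring m → ℕ → Fin m → List (Fin m) → List Colour → Bool
extension : ∀ {m} → PartialColouring m → ℕ → Fin m → List (Fin m) → List Colour →
            Fin m × Colour → Bool
trail α zero    u us cs = true
trail α (suc k) u us cs = any (extension α k u us cs) (Vec.lookup α u)
extension α k u us cs (q , c) =
  fresh c cs ∧ (fresh q (u ∷ us) ∧ trail α k q (u ∷ us) (c ∷ cs))

anyTrail : ∀ {m} → PartialColouring m → Bool
anyTrail α = any (λ u → trail α 4 u [] []) (allFin _)

-- Colouring the edges es one after the other always creates a rainbow path.
doomed : ∀ {m} → List (Fin m × Fin m) → PartialColouring m → Bool
doomed []             α = anyTrail α
doomed ((p , q) ∷ es) α =
  -- Testing before each further edge cuts a branch off as soon as a rainbow path is present.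
  anyTrail α ∨ all (λ c → doomed es ((p , q , c) ▹ α)) (allFin 4)

agreeOrDoomed : ∀ {m} → Fin m → Fin m → Fin m → List (Fin m × Fin m) → PartialColouring m →
                Colour → Colour → Bool
agreeOrDoomed p q r es α c c′ =
  (c == c′) ∨ doomed es ((p , q , c) ▹ (p , r , c′) ▹ α)

-- Later `p`, `q`, `r` are vertices outside a fixed configuration, and `es` lists auxiliary edges
-- whose colouring exposes a rainbow path when `pq` and `pr` differ.
forced : ∀ {m} → Fin m → Fin m → Fin m → List (Fin m × Fin m) → PartialColouring m → Bool
forced p q r es α = all (λ c → all (agreeOrDoomed p q r es α c) (allFin 4)) (allFin 4)

==-refl : ∀ {m} {i j : Fin m} → i ≡ j → T (i == j)
==-refl {i = i} refl = ≡⇒≡ᵇ (toℕ i) (toℕ i) refl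

==-sound : ∀ {m} {i j : Fin m} → T (i == j) → i ≡ j
==-sound {i = i} {j} = toℕ-injective ∘ ≡ᵇ⇒≡ (toℕ i) (toℕ j)

T-not : ∀ {b} → T (not b) → ¬ T b
T-not {false} _ ()

T-all : ∀ {m} (p : Fin m → Bool) → T (all p (allFin m)) → ∀ i → T (p i)
T-all p t i = All.lookup (All.all⁺ p _ t) (∈-allFin i)

fresh-sound : ∀ {m} {x : Fin m} {ys} → T (fresh x ys) → All (x ≢_) ys
fresh-sound t = All.map (λ ne eq → T-not ne (==-refl eq)) (All.all⁺ _ _ t)

module Soundness
  {m n} (col : Fin n → Fin n → Colour) (col-sym : ∀ u v → col u v ≡ col v u)
  (noRainbow : ¬ RainbowPath col)
  (vertex : Fin m → Fin n) (vertex-injective : Injective _≡_ _≡_ vertex)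
  (palette : Fin 4 → Colour) (palette-injective : Injective _≡_ _≡_ palette)
  (palette-surjective : ∀ c → ∃[ k ] palette k ≡ c)
  where

  -- The search uses the colour names 0 to 3; `palette` translates them, so one search covers every
  -- choice of actual colours. Being a record keeps `α` inferable.
  record Extends (α : PartialColouring m) : Set where
    field
      agrees : ∀ u → All (λ (q , c) → col (vertex u) (vertex q) ≡ palette c) (Vec.lookup α u)
  open Extends

  extends-empty : Extends (Vec.replicate m [])
  extends-empty .agrees u = subst (All _) (sym (lookup-replicate u [])) []

  extends-insert : ∀ {p q c α} → col (vertex p) (vertex q) ≡ palette c → Extends α →
                   Extends (updateAt α p ((q , c) ∷_))
  extends-insert {p} {α = α} eq ext .agrees u with u ≟ᶠ p
  ... | yes refl = subst (All _) (sym (lookup∘updateAt p α)) (eq ∷ ext .agrees p)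
  ... | no  u≢p  = subst (All _) (sym (lookup∘updateAt′ u p u≢p α)) (ext .agrees u)

  extends-▹ : ∀ {p q c α} → col (vertex p) (vertex q) ≡ palette c → Extends α →
              Extends ((p , q , c) ▹ α)
  extends-▹ eq ext = extends-insert (trans (col-sym _ _) eq) (extends-insert eq ext)

  trail-step : ∀ {α} k {u us cs} → Extends α → T (trail α (suc k) u us cs) →
               ∃[ q ] ∃[ c ] All (c ≢_) cs × All (q ≢_) (u ∷ us) ×
               T (trail α k q (u ∷ us) (c ∷ cs)) × col (vertex q) (vertex u) ≡ palette c
  trail-step {α} k {u} {us} {cs} ext t
    with (q , c) , mem , t′ ← find (any⁻ (extension α k u us cs) _ t)
    with f , t″ ← Equivalence.to (T-∧ {fresh c cs}) t′
    with g , h ← Equivalence.to (T-∧ {fresh q (u ∷ us)}) t″ =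
    q , c , fresh-sound f , fresh-sound g , h ,
    trans (col-sym _ _) (All.lookup (ext .agrees u) mem)

  no-trail : ∀ {α} → Extends α → ¬ T (anyTrail α)
  no-trail {α} ext t
    with v₁ , _ , t₁ ← find (any⁻ (λ u → trail α 4 u [] []) (allFin m) t)
    with v₂ , c₂ , d₂ , w₂ , t₂ , e₂ ← trail-step 3 ext t₁
    with v₃ , c₃ , d₃ , w₃ , t₃ , e₃ ← trail-step 2 ext t₂
    with v₄ , c₄ , d₄ , w₄ , t₄ , e₄ ← trail-step 1 ext t₃
    with v₅ , c₅ , d₅ , w₅ , _  , e₅ ← trail-step 0 ext t₄ =
    noRainbow
      -- The search accumulates the latest vertex and colour first, so the path is read backwards
      -- and the freshness proofs are its uniqueness proofs.
      ( vertex v₅ , vertex v₄ , vertex v₃ , vertex v₂ , vertex v₁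
      , Unique.map⁺ vertex-injective (w₅ ∷ w₄ ∷ w₃ ∷ w₂ ∷ [] ∷ [])
      , subst Unique
          (sym (cong₂ _∷_ e₅ (cong₂ _∷_ e₄ (cong₂ _∷_ e₃ (cong₂ _∷_ e₂ refl)))))
          (Unique.map⁺ palette-injective (d₅ ∷ d₄ ∷ d₃ ∷ d₂ ∷ [])) )

  doomed-sound : ∀ es {α} → Extends α → ¬ T (doomed es α)
  doomed-sound []             ext t = no-trail ext t
  doomed-sound ((p , q) ∷ es) {α} ext t with Equivalence.to (T-∨ {anyTrail α}) t
  ... | inj₁ t′ = no-trail ext t′
  -- Of the four branches, follow the one for the colour that `pq` really has.
  ... | inj₂ t′ with c , eq ← palette-surjective (col (vertex p) (vertex q)) =
    doomed-sound es (extends-▹ (sym eq) ext)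
      (T-all (λ c → doomed es ((p , q , c) ▹ α)) t′ c)

  forced-sound : ∀ p q r es {α} → Extends α → T (forced p q r es α) →
                 col (vertex p) (vertex q) ≡ col (vertex p) (vertex r)
  forced-sound p q r es {α} ext t
    with c  , eq  ← palette-surjective (col (vertex p) (vertex q))
    with c′ , eq′ ← palette-surjective (col (vertex p) (vertex r))
    with Equivalence.to (T-∨ {c == c′})
           (T-all (λ c′ → agreeOrDoomed p q r es α c c′)
             (T-all (λ c → all (agreeOrDoomed p q r es α c) (allFin 4)) t c) c′)
  ... | inj₁ c==c′ = trans (sym eq) (trans (cong palette (==-sound c==c′)) eq′)
  ... | inj₂ t′ = ⊥-elim (doomed-sound es (extends-▹ (sym eq) (extends-▹ (sym eq′) ext)) t′)

-- The claw in normal form: centre 0 and leaves 1, 2, 3. Colour 3 is left to stand for the fourth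
-- colour.
spokes : ∀ m → PartialColouring (4 + m)
spokes m = (# 0 , # 1 , # 0) ▹ (# 0 , # 2 , # 1) ▹ (# 0 , # 3 , # 2) ▹ Vec.replicate _ []

-- Small Ramsey numbers

-- Distinctness of the members comes from `Q` itself, as with `Edge`.
Clique : ∀ {A : Set} → (A → A → Set) → ℕ → List A → Set
Clique Q k xs = ∃[ ys ] length ys ≡ k × AllPairs Q ys × ys ⊆ xs

Clique-⊆ : ∀ {A : Set} {Q : A → A → Set} {k xs ys} → xs ⊆ ys → Clique Q k xs → Clique Q k ys
Clique-⊆ xs⊆ys (zs , len , pairs , zs⊆xs) = zs , len , pairs , xs⊆ys ∘ zs⊆xs

Clique-∷ : ∀ {A : Set} {Q : A → A → Set} (Q? : Decidable Q) {k x xs} → x ∈ xs →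
           Clique Q k (filter (Q? x) xs) → Clique Q (suc k) xs
Clique-∷ Q? {x = x} {xs} x∈xs (ys , len , pairs , ys⊆) =
  x ∷ ys , cong suc len , All.tabulate (proj₂ ∘ ∈-filter⁻ (Q? x) {xs = xs} ∘ ys⊆) ∷ pairs ,
  λ { (here refl) → x∈xs ; (there y∈ys) → filter-⊆ (Q? x) xs (ys⊆ y∈ys) }

module _ {A : Set} {P Q : A → Set} (P? : U.Decidable P) (Q? : U.Decidable Q) where

  length-filter-∪ : ∀ xs → length (filter (P? ∪? Q?) xs) ≤
                           length (filter P? xs) + length (filter Q? xs)
  length-filter-∪ [] = z≤n
  length-filter-∪ (x ∷ xs) with ih ← length-filter-∪ xs | P? x | Q? x
  ... | yes _ | yes _ = s≤s (≤-trans ih (+-monoʳ-≤ (length (filter P? xs)) (n≤1+n _)))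
  ... | yes _ | no  _ = s≤s ih
  ... | no  _ | yes _ = ≤-trans (s≤s ih) (≤-reflexive (sym (+-suc _ _)))
  ... | no  _ | no  _ = ih

  length-cover : ∀ {xs} → All (P U.∪ Q) xs →
                 length xs ≤ length (filter P? xs) + length (filter Q? xs)
  length-cover {xs} pqs =
    ≤-trans (≤-reflexive (cong length (sym (filter-all (P? ∪? Q?) pqs)))) (length-filter-∪ xs)

module Ramsey {A : Set} {R B : A → A → Set} (R? : Decidable R) (B? : Decidable B)
              (R-sym : Symmetric R) (B-sym : Symmetric B) (R-irrefl : ∀ {x} → ¬ R x x) where

  TwoColoured : List A → Set
  TwoColoured = AllPairs (λ x y → R x y ⊎ B x y)

  infix 4 _⟶⟨_,_⟩
  -- The Ramsey arrow N → (a, b), stated for all lists so that it applies inside a neighbourhood.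
  _⟶⟨_,_⟩ : ℕ → ℕ → ℕ → Set
  N ⟶⟨ a , b ⟩ = ∀ xs → TwoColoured xs → N ≤ length xs → Clique R a xs ⊎ Clique B b xs

  degree : A → List A → ℕ
  degree x xs = length (filter (R? x) xs)

  codegree : A → List A → ℕ
  codegree x xs = length (filter (B? x) xs)

  -- Every other member is counted by at least one of the two degrees; `suc` pays for `x`.
  length≤degrees : ∀ {x xs} → x ∈ xs → TwoColoured xs →
                   length xs ≤ suc (degree x xs + codegree x xs)
  length≤degrees {x} {y ∷ ys} (here refl) (pq ∷ _) =
    s≤s (≤-trans (length-cover (R? x) (B? x) pq)
                 (+-mono-≤ (drop (R? x)) (drop (B? x))))
    where
    drop : ∀ {P : A → Set} (P? : U.Decidable P) →
           length (filter P? ys) ≤ length (filter P? (y ∷ ys))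
    drop P? with P? y
    ... | yes _ = n≤1+n _
    ... | no  _ = ≤-refl
  length≤degrees {x} {y ∷ ys} (there x∈ys) (pq ∷ pqs) with ih ← length≤degrees x∈ys pqs
    | R? x y | B? x y | All.lookup pq x∈ys
  ... | yes _ | yes _ | _ = s≤s (≤-trans ih (s≤s (+-monoʳ-≤ (degree x ys) (n≤1+n _))))
  ... | yes _ | no  _ | _ = s≤s ih
  ... | no  _ | yes _ | _ = s≤s (≤-trans ih (≤-reflexive (sym (+-suc _ _))))
  ... | no ¬r | no ¬b | yx = ⊥-elim ([ ¬r ∘ R-sym , ¬b ∘ B-sym ]′ yx)

  redNeighbourhood : ∀ {N a b x xs} → N ⟶⟨ a , b ⟩ → x ∈ xs → TwoColoured xs →
                     N ≤ degree x xs → Clique R (suc a) xs ⊎ Clique B b xs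
  redNeighbourhood {x = x} {xs} arrow x∈xs pqs N≤ =
    Sum.map (Clique-∷ R? x∈xs) (Clique-⊆ (filter-⊆ (R? x) xs))
            (arrow _ (AllPairs.filter⁺ (R? x) pqs) N≤)

  blueNeighbourhood : ∀ {N a b x xs} → N ⟶⟨ a , b ⟩ → x ∈ xs → TwoColoured xs →
                      N ≤ codegree x xs → Clique R a xs ⊎ Clique B (suc b) xs
  blueNeighbourhood {x = x} {xs} arrow x∈xs pqs N≤ =
    Sum.map (Clique-⊆ (filter-⊆ (B? x) xs)) (Clique-∷ B? x∈xs)
            (arrow _ (AllPairs.filter⁺ (B? x) pqs) N≤)

  -- The Erdős-Szekeres recursion, applied at the first vertex: red degree at most `M` leaves at
  -- least `N` blue neighbours.
  ⟶-step : ∀ {M N a b} → suc M ⟶⟨ a , suc b ⟩ → N ⟶⟨ suc a , b ⟩ →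
           suc M + N ⟶⟨ suc a , suc b ⟩
  ⟶-step {M} {N} red blue (x ∷ xs) pqs (s≤s len) with suc M ≤? degree x (x ∷ xs)
  ... | yes M<d = redNeighbourhood red (here refl) pqs M<d
  ... | no  M≮d = blueNeighbourhood blue (here refl) pqs (+-cancelˡ-≤ M _ _ (begin
      M + N                        ≤⟨ len ⟩
      length xs                    ≤⟨ s≤s⁻¹ (length≤degrees (here refl) pqs) ⟩
      degree x zs + codegree x zs  ≤⟨ +-monoˡ-≤ _ (≮⇒≥ M≮d) ⟩
      M + codegree x zs            ∎))
    where
    open ≤-Reasoning
    zs = x ∷ xs

  singletonClique : ∀ {Q : A → A → Set} {xs} → 1 ≤ length xs → Clique Q 1 xs
  singletonClique {xs = x ∷ xs} _ = x ∷ [] , refl , [] ∷ [] , λ { (here refl) → here refl }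

  1⟶⟨1,b⟩ : ∀ {b} → 1 ⟶⟨ 1 , b ⟩
  1⟶⟨1,b⟩ _ _ = inj₁ ∘ singletonClique

  1⟶⟨a,1⟩ : ∀ {a} → 1 ⟶⟨ a , 1 ⟩
  1⟶⟨a,1⟩ _ _ = inj₂ ∘ singletonClique

  b⟶⟨2,b⟩ : ∀ b → b ⟶⟨ 2 , b ⟩
  b⟶⟨2,b⟩ zero    _ _ _ = inj₂ ([] , refl , [] , λ ())
  b⟶⟨2,b⟩ (suc b) = ⟶-step 1⟶⟨1,b⟩ (b⟶⟨2,b⟩ b)

  6⟶⟨3,3⟩ : 6 ⟶⟨ 3 , 3 ⟩
  6⟶⟨3,3⟩ = ⟶-step (b⟶⟨2,b⟩ 3) (⟶-step (b⟶⟨2,b⟩ 2) 1⟶⟨a,1⟩)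

  -- `degree x (y ∷ [])` serves as the 0-1 entry of the red adjacency matrix.
  degree-∷ : ∀ x y ys → degree x (y ∷ ys) ≡ degree x (y ∷ []) + degree x ys
  degree-∷ x y ys with R? x y
  ... | yes _ = refl
  ... | no  _ = refl

  degree-comm : ∀ x y → degree x (y ∷ []) ≡ degree y (x ∷ [])
  degree-comm x y with R? x y | R? y x
  ... | yes _  | yes _  = refl
  ... | no _   | no _   = refl
  ... | yes xy | no ¬yx = ⊥-elim (¬yx (R-sym xy))
  ... | no ¬xy | yes yx = ⊥-elim (¬xy (R-sym yx))

  -- The new `y` raises the degree of each of its neighbours in `xs` by one. The two lists are
  -- independent so that the induction can run over `xs` alone.
  sum-degree-∷ : ∀ y xs ys → sum (map (λ x → degree x (y ∷ ys)) xs) ≡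
                             degree y xs + sum (map (λ x → degree x ys) xs)
  sum-degree-∷ y []       ys = refl
  sum-degree-∷ y (x ∷ xs) ys = begin
    degree x (y ∷ ys) + sum (map (λ x → degree x (y ∷ ys)) xs)
      ≡⟨ cong₂ _+_ (trans (degree-∷ x y ys) (cong (_+ degree x ys) (degree-comm x y)))
                   (sum-degree-∷ y xs ys) ⟩
    (e + degree x ys) + (degree y xs + s)
      ≡⟨ interchange +-commutativeSemigroup e _ _ s ⟩
    (e + degree y xs) + (degree x ys + s)
      ≡⟨ cong (_+ (degree x ys + s)) (degree-∷ y x xs) ⟨
    degree y (x ∷ xs) + (degree x ys + s) ∎
    where
    open ≡-Reasoning
    e = degree y (x ∷ [])
    s = sum (map (λ x → degree x ys) xs)

  -- The degree of a new vertex enters the sum twice: as its own term and through its neighbours.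
  handshake : ∀ xs → 2 ∣ sum (map (λ x → degree x xs) xs)
  handshake []       = divides 0 refl
  handshake (y ∷ ys) = subst (2 ∣_) (sym eq) (∣m∣n⇒∣m+n (divides d d+d≡d*2) (handshake ys))
    where
    open ≡-Reasoning
    d = degree y ys
    s = sum (map (λ x → degree x ys) ys)
    d+d≡d*2 : d + d ≡ d * 2
    d+d≡d*2 = sym (trans (*-comm d 2) (cong (d +_) (+-identityʳ d)))
    eq : sum (map (λ x → degree x (y ∷ ys)) (y ∷ ys)) ≡ (d + d) + s
    eq = begin
      degree y (y ∷ ys) + sum (map (λ x → degree x (y ∷ ys)) ys)
        ≡⟨ cong₂ _+_ (cong length (filter-reject (R? y) R-irrefl)) (sum-degree-∷ y ys ys) ⟩
      d + (d + s)
        ≡⟨ +-assoc d d s ⟨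
      (d + d) + s ∎

  sum-constant : ∀ (f : A → ℕ) k {xs} → All (λ x → f x ≡ k) xs → sum (map f xs) ≡ length xs * k
  sum-constant f k []         = refl
  sum-constant f k (eq ∷ eqs) = cong₂ _+_ eq (sum-constant f k eqs)

  -- Otherwise the red graph is 3-regular on 9 vertices, against the handshake lemma.
  9⟶⟨3,4⟩ : 9 ⟶⟨ 3 , 4 ⟩
  9⟶⟨3,4⟩ xs pqs 9≤ =
    Sum.map (Clique-⊆ zs⊆xs) (Clique-⊆ zs⊆xs) main
    where
    -- Exactly nine vertices are kept, so that a cubic red graph has the odd degree sum 27.
    zs = take 9 xs
    zs⊆xs : zs ⊆ xs
    zs⊆xs = Sublist.lookup (take-⊆ 9 xs)
    |zs|≡9 : length zs ≡ 9
    |zs|≡9 = trans (length-take 9 xs) (m≤n⇒m⊓n≡m 9≤)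
    zs-coloured : TwoColoured zs
    zs-coloured = AllPairs.take⁺ 9 pqs
    main : Clique R 3 zs ⊎ Clique B 4 zs
    main with All.all? (λ x → degree x zs ≟ 3) zs
    ... | yes cubic = ⊥-elim (from-no (2 ∣? 27) (subst (2 ∣_)
            (trans (sum-constant _ 3 cubic) (cong (_* 3) |zs|≡9)) (handshake zs)))
    ... | no ¬cubic with find (All.¬All⇒Any¬ (λ x → degree x zs ≟ 3) zs ¬cubic)
    ... | x , x∈zs , d≢3 with <-cmp (degree x zs) 3
    ... | tri≈ _ d≡3 _ = ⊥-elim (d≢3 d≡3)
    -- Four red neighbours suffice by R(2,4) ≤ 4. Red degree at most 2 leaves six blue neighbours,
    -- and R(3,3) ≤ 6.
    ... | tri> _ _ 3<d = redNeighbourhood (b⟶⟨2,b⟩ 4) x∈zs zs-coloured 3<d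
    ... | tri< d<3 _ _ = blueNeighbourhood 6⟶⟨3,3⟩ x∈zs zs-coloured (+-cancelˡ-≤ 3 _ _ (begin
        9                                ≡⟨ |zs|≡9 ⟨
        length zs                        ≤⟨ length≤degrees x∈zs zs-coloured ⟩
        suc (degree x zs) + codegree x zs ≤⟨ +-monoˡ-≤ _ d<3 ⟩
        3 + codegree x zs                ∎))
      where open ≤-Reasoning

  14⟶⟨3,5⟩ : 14 ⟶⟨ 3 , 5 ⟩
  14⟶⟨3,5⟩ = ⟶-step (b⟶⟨2,b⟩ 5) 9⟶⟨3,4⟩

-- Colourings without rainbow paths and pineapples

-- Pigeonhole: sending a member of `xs` to its position in `ys` is injective.
Unique-⊆⇒length≤ : ∀ {A : Set} {xs ys : List A} → Unique xs → xs ⊆ ys → length xs ≤ length ys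
Unique-⊆⇒length≤ {xs = xs} {ys} uniq xs⊆ys = injective⇒≤ {f = position} position-injective
  where
  position : Fin (length xs) → Fin (length ys)
  position i = index (xs⊆ys (∈-lookup i))

  position-injective : ∀ {i j} → position i ≡ position j → i ≡ j
  position-injective {i} {j} eq = Unique-lookup uniq
    (trans (lookup-index (xs⊆ys (∈-lookup i)))
      (trans (cong (lookup ys) eq) (sym (lookup-index (xs⊆ys (∈-lookup j))))))

Unique⇒AllPairs : ∀ {A : Set} {R : A → A → Set} {xs} → Unique xs →
                  (∀ {u v} → u ∈ xs → v ∈ xs → u ≢ v → R u v) → AllPairs R xs
Unique⇒AllPairs []         r = []
Unique⇒AllPairs (px ∷ pxs) r =
  All.tabulate (λ y∈xs → r (here refl) (there y∈xs) (All.lookup px y∈xs)) ∷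
  Unique⇒AllPairs pxs (λ u∈xs v∈xs → r (there u∈xs) (there v∈xs))

module _ {n : ℕ} where
  open DecMembership (_≟ᶠ_ {n}) using (_∈?_) public

infixl 6 _∖_
_∖_ : ∀ {n} → List (Fin n) → List (Fin n) → List (Fin n)
xs ∖ ys = filter (∁? (_∈? ys)) xs

length-∖ : ∀ {n} {xs : List (Fin n)} ys → Unique xs → length xs ≤ length ys + length (xs ∖ ys)
length-∖ {xs = xs} ys uniq = ≤-trans
  (length-cover in? (∁? in?) (All.universal (λ x → toSum (in? x)) xs))
  (+-monoˡ-≤ _ (Unique-⊆⇒length≤ (Unique.filter⁺ in? uniq) (proj₂ ∘ ∈-filter⁻ in? {xs = xs})))
  where
  in? = _∈? ys

unique? : ∀ {n} (xs : List (Fin n)) → Dec (Unique xs)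
unique? = allPairs? (λ i j → ¬? (i ≟ᶠ j))

-- Abstract, as matching on an instance would otherwise unfold the exhaustive check.
abstract
  palette-surjective : ∀ {i j k l : Colour} → Unique (i ∷ j ∷ k ∷ l ∷ []) →
                       ∀ c → ∃[ t ] lookup (i ∷ j ∷ k ∷ l ∷ []) t ≡ c
  palette-surjective {i} {j} {k} {l} = toWitness
    {a? = all? λ i → all? λ j → all? λ k → all? λ l →
          unique? (i ∷ j ∷ k ∷ l ∷ []) →-dec
          all? λ c → any? λ t → lookup (i ∷ j ∷ k ∷ l ∷ []) t ≟ᶠ c} _ i j k l

  complete₃ : ∀ {i j k : Colour} → Unique (i ∷ j ∷ k ∷ []) → ∃[ l ] Unique (i ∷ j ∷ k ∷ l ∷ [])
  complete₃ {i} {j} {k} = toWitness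
    {a? = all? λ i → all? λ j → all? λ k →
          unique? (i ∷ j ∷ k ∷ []) →-dec any? λ l → unique? (i ∷ j ∷ k ∷ l ∷ [])} _ i j k

  complete₂ : ∀ {i j : Colour} → i ≢ j → ∃[ k ] ∃[ l ] Unique (i ∷ j ∷ k ∷ l ∷ [])
  complete₂ {i} {j} = toWitness
    {a? = all? λ i → all? λ j →
          ¬? (i ≟ᶠ j) →-dec any? λ k → any? λ l → unique? (i ∷ j ∷ k ∷ l ∷ [])} _ i j

Edge : ∀ {n} → (Fin n → Fin n → Colour) → Colour → Fin n → Fin n → Set
Edge col c u v = u ≢ v × col u v ≡ c

edge? : ∀ {n} (col : Fin n → Fin n → Colour) c → Decidable (Edge col c)
edge? col c u v = ¬? (u ≟ᶠ v) ×-dec (col u v ≟ᶠ c)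

-- `q` is the clique vertex that carries the pendent vertex `p`; `Edge` already contains `q ≢ p`.
Pineapple : ∀ {n} → (Fin n → Fin n → Colour) → Set
Pineapple col = ∃[ c ] ∃[ q ] ∃[ q₁ ] ∃[ q₂ ] ∃[ q₃ ] ∃[ q₄ ] ∃[ p ]
  AllPairs (Edge col c) (q ∷ q₁ ∷ q₂ ∷ q₃ ∷ q₄ ∷ []) × Edge col c q p ×
  All (p ≢_) (q₁ ∷ q₂ ∷ q₃ ∷ q₄ ∷ [])

module Structure
  {n} (24≤n : 24 ≤ n) (col : Fin n → Fin n → Colour) (col-sym : ∀ u v → col u v ≡ col v u)
  (exact : ∀ c → ∃[ u ] ∃[ v ] Edge col c u v)
  (noRainbow : ¬ RainbowPath col) (noPineapple : ¬ Pineapple col)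
  where

  edge-sym : ∀ {c} → Symmetric (Edge col c)
  edge-sym (u≢v , eq) = u≢v ∘ sym , trans (col-sym _ _) eq

  makePineapple : ∀ {c q p} qs → length qs ≡ 4 → AllPairs (Edge col c) (q ∷ qs) →
                  Edge col c q p → p ∉ qs → ⊥
  makePineapple (q₁ ∷ q₂ ∷ q₃ ∷ q₄ ∷ []) refl pairs qp p∉ =
    noPineapple (_ , _ , q₁ , q₂ , q₃ , q₄ , _ , pairs , qp , All.¬Any⇒All¬ _ p∉)

  -- One vertex of a K₆ serves as the pendent vertex of a K₅ on the others.
  noClique₆ : ∀ {c xs} → 6 ≤ length xs → ¬ AllPairs (Edge col c) xs
  noClique₆ {xs = _ ∷ []}                 (s≤s ())
  noClique₆ {xs = _ ∷ _ ∷ []}             (s≤s (s≤s ()))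
  noClique₆ {xs = _ ∷ _ ∷ _ ∷ []}         (s≤s (s≤s (s≤s ())))
  noClique₆ {xs = _ ∷ _ ∷ _ ∷ _ ∷ []}     (s≤s (s≤s (s≤s (s≤s ()))))
  noClique₆ {xs = _ ∷ _ ∷ _ ∷ _ ∷ _ ∷ []} (s≤s (s≤s (s≤s (s≤s (s≤s ())))))
  noClique₆ {xs = p ∷ q ∷ q₁ ∷ q₂ ∷ q₃ ∷ q₄ ∷ xs} _ ((pq ∷ pqs) ∷ pairs) =
    makePineapple (q₁ ∷ q₂ ∷ q₃ ∷ q₄ ∷ []) refl (AllPairs.take⁺ 5 pairs) (edge-sym pq)
      (All.All¬⇒¬Any (All.map proj₁ (All.take⁺ 4 pqs)))

  -- At least 24 - 6 = 18 vertices lie outside `s`. If any two edges that meet there agree, all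
  -- edges there have one colour, which yields a K₆.
  notMonochromaticOutside : ∀ s → length s ≤ 6 → Unique s →
    ¬ (∀ w₁ w₂ w₃ → Unique (s ++ w₁ ∷ w₂ ∷ w₃ ∷ []) → col w₁ w₂ ≡ col w₁ w₃)
  notMonochromaticOutside s |s|≤6 s-unique rule = go _ refl 18≤rest
    where
    rest = allFin n ∖ s
    18≤rest : 18 ≤ length rest
    18≤rest = +-cancelˡ-≤ 6 _ _ (begin
      24                     ≤⟨ 24≤n ⟩
      n                      ≡⟨ length-tabulate id ⟨
      length (allFin n)      ≤⟨ length-∖ s (Unique.allFin⁺ n) ⟩
      length s + length rest ≤⟨ +-monoˡ-≤ _ |s|≤6 ⟩
      6 + length rest        ∎)
      where open ≤-Reasoning
    rule′ : ∀ {w₁ w₂ w₃} → w₁ ∈ rest → w₂ ∈ rest → w₃ ∈ rest →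
            w₁ ≢ w₂ → w₁ ≢ w₃ → col w₁ w₂ ≡ col w₁ w₃
    rule′ {w₁} {w₂} {w₃} m₁ m₂ m₃ w₁≢w₂ w₁≢w₃ with w₂ ≟ᶠ w₃
    ... | yes refl  = refl
    ... | no  w₂≢w₃ = rule w₁ w₂ w₃
      (Unique.++⁺ s-unique ((w₁≢w₂ ∷ w₁≢w₃ ∷ []) ∷ (w₂≢w₃ ∷ []) ∷ [] ∷ [])
        λ { (m , here refl)                 → outside m₁ m
          ; (m , there (here refl))         → outside m₂ m
          ; (m , there (there (here refl))) → outside m₃ m })
      where
      outside : ∀ {w} → w ∈ rest → w ∉ s
      outside = proj₂ ∘ ∈-filter⁻ (∁? (_∈? s)) {xs = allFin n}
    rest-unique : Unique rest
    rest-unique = Unique.filter⁺ _ (Unique.allFin⁺ n)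
    go : ∀ xs → xs ≡ rest → 18 ≤ length xs → ⊥
    go (w ∷ w′ ∷ ws) eq 18≤ =
      noClique₆ (≤-trans (m≤m+n 6 12) 18≤)
                (Unique⇒AllPairs (subst Unique (sym eq) rest-unique) same)
      where
      mem : ∀ {u} → u ∈ w ∷ w′ ∷ ws → u ∈ rest
      mem = subst (_ ∈_) eq
      w≢w′ : w ≢ w′
      w≢w′ = All.head (AllPairs.head (subst Unique (sym eq) rest-unique))
      same : ∀ {u v} → u ∈ w ∷ w′ ∷ ws → v ∈ w ∷ w′ ∷ ws → u ≢ v → Edge col (col w w′) u v
      same {u} {v} mu mv u≢v with u ≟ᶠ w
      ... | yes refl = u≢v , rule′ (mem mu) (mem mv) (mem (there (here refl))) u≢v w≢w′
      -- One end is changed at a time: `uv` to `uw` around `u`, then `wu` to `ww′` around `w`.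
      ... | no  u≢w  = u≢v , (begin
        col u v  ≡⟨ rule′ (mem mu) (mem mv) (mem (here refl)) u≢v u≢w ⟩
        col u w  ≡⟨ col-sym u w ⟩
        col w u  ≡⟨ rule′ (mem (here refl)) (mem mu) (mem (there (here refl))) (u≢w ∘ sym) w≢w′ ⟩
        col w w′ ∎)
        where open ≡-Reasoning
    go (_ ∷ []) _ (s≤s ())

  -- Claws with three colours

  record Claw (x a b c : Fin n) (i j k l : Colour) : Set where
    field
      vertices : Unique (x ∷ a ∷ b ∷ c ∷ [])
      colours  : Unique (i ∷ j ∷ k ∷ l ∷ [])
      xa       : col x a ≡ i
      xb       : col x b ≡ j
      xc       : col x c ≡ k

  -- Together with `swap₂₃` this moves any leaf into first place, so edges at a leaf need a search
  -- only for `a`.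
  swap₁₂ : ∀ {x a b c i j k l} → Claw x a b c i j k l → Claw x b a c j i k l
  swap₁₂ record { vertices = (xa ∷ xb ∷ xc ∷ []) ∷ (ab ∷ ac ∷ []) ∷ (bc ∷ []) ∷ v
                ; colours  = (ij ∷ ik ∷ il ∷ []) ∷ (jk ∷ jl ∷ []) ∷ c
                ; xa = p ; xb = q ; xc = r } =
    record { vertices = (xb ∷ xa ∷ xc ∷ []) ∷ ((ab ∘ sym) ∷ bc ∷ []) ∷ (ac ∷ []) ∷ v
           ; colours  = ((ij ∘ sym) ∷ jk ∷ jl ∷ []) ∷ (ik ∷ il ∷ []) ∷ c
           ; xa = q ; xb = p ; xc = r }

  swap₂₃ : ∀ {x a b c i j k l} → Claw x a b c i j k l → Claw x a c b i k j l
  swap₂₃ record { vertices = (xa ∷ xb ∷ xc ∷ []) ∷ (ab ∷ ac ∷ []) ∷ (bc ∷ []) ∷ v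
                ; colours  = (ij ∷ ik ∷ il ∷ []) ∷ (jk ∷ jl ∷ []) ∷ (kl ∷ []) ∷ c
                ; xa = p ; xb = q ; xc = r } =
    record { vertices = (xa ∷ xc ∷ xb ∷ []) ∷ (ac ∷ ab ∷ []) ∷ ((bc ∘ sym) ∷ []) ∷ [] ∷ []
           ; colours  = (ik ∷ ij ∷ il ∷ []) ∷ ((jk ∘ sym) ∷ kl ∷ []) ∷ (jl ∷ []) ∷ c
           ; xa = p ; xb = r ; xc = q }

  module _ {x a b c i j k l} (claw : Claw x a b c i j k l) where
    open Claw claw

    module Around (ws : List (Fin n)) (uniq : Unique (x ∷ a ∷ b ∷ c ∷ ws)) where
      open Soundness col col-sym noRainbow
        (lookup (x ∷ a ∷ b ∷ c ∷ ws)) (Unique-lookup uniq)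
        (lookup (i ∷ j ∷ k ∷ l ∷ [])) (Unique-lookup colours) (palette-surjective colours) public

      extends-spokes : Extends (spokes (length ws))
      extends-spokes =
        extends-▹ {p = # 0} {# 1} {# 0} xa (
        extends-▹ {p = # 0} {# 2} {# 1} xb (
        extends-▹ {p = # 0} {# 3} {# 2} xc extends-empty))

    append : ∀ {ys} → All (_∉ x ∷ a ∷ b ∷ c ∷ []) ys → Unique ys →
             Unique (x ∷ a ∷ b ∷ c ∷ ys)
    append ys∉ ys-unique =
      Unique.++⁺ vertices ys-unique λ (∈claw , ∈ys) → All.lookup ys∉ ∈ys ∈claw

    -- In the four searches below the vertices 0, 1, 2, 3 stand for x, a, b, c and
    -- the last three for w₁, w₂, w₃; the edge lists were found by computer, such
    -- that at most a few hundred partial colourings are visited.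
    ab-avoids : col a b ≢ l
    ab-avoids ab = notMonochromaticOutside (x ∷ a ∷ b ∷ c ∷ []) (m≤m+n 4 2) vertices
      λ w₁ w₂ w₃ uniq → let open Around (w₁ ∷ w₂ ∷ w₃ ∷ []) uniq in
        forced-sound (# 4) (# 5) (# 6)
          ((# 1 , # 4) ∷ (# 3 , # 4) ∷ (# 2 , # 3) ∷ (# 2 , # 6) ∷ (# 2 , # 5) ∷ (# 1 , # 3) ∷ [])
          (extends-▹ {p = # 1} {# 2} {# 3} ab extends-spokes) _

    xz-avoids : ∀ {z} → z ∉ x ∷ a ∷ b ∷ c ∷ [] → col x z ≢ l
    xz-avoids {z} z∉ xz = notMonochromaticOutside (x ∷ a ∷ b ∷ c ∷ z ∷ []) (m≤m+n 5 1)
      (append (z∉ ∷ []) ([] ∷ []))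
      λ w₁ w₂ w₃ uniq → let open Around (z ∷ w₁ ∷ w₂ ∷ w₃ ∷ []) uniq in
        forced-sound (# 5) (# 6) (# 7)
          ((# 4 , # 5) ∷ (# 2 , # 5) ∷ (# 3 , # 5) ∷ (# 1 , # 5) ∷
           (# 0 , # 6) ∷ (# 0 , # 7) ∷ (# 1 , # 4) ∷ (# 2 , # 3) ∷ [])
          (extends-▹ {p = # 0} {# 4} {# 3} xz extends-spokes) _

    az-avoids : ∀ {z} → z ∉ x ∷ a ∷ b ∷ c ∷ [] → col a z ≢ l
    az-avoids {z} z∉ az = notMonochromaticOutside (x ∷ a ∷ b ∷ c ∷ z ∷ []) (m≤m+n 5 1)
      (append (z∉ ∷ []) ([] ∷ []))
      λ w₁ w₂ w₃ uniq → let open Around (z ∷ w₁ ∷ w₂ ∷ w₃ ∷ []) uniq in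
        forced-sound (# 5) (# 6) (# 7)
          ((# 2 , # 5) ∷ (# 2 , # 3) ∷ (# 1 , # 2) ∷ (# 3 , # 4) ∷ (# 3 , # 5) ∷ [])
          (extends-▹ {p = # 1} {# 4} {# 3} az extends-spokes) _

    yz-avoids : ∀ {y z} → y ∉ x ∷ a ∷ b ∷ c ∷ [] → z ∉ x ∷ a ∷ b ∷ c ∷ [] →
                ¬ Edge col l y z
    yz-avoids {y} {z} y∉ z∉ (y≢z , yz) =
      notMonochromaticOutside (x ∷ a ∷ b ∷ c ∷ y ∷ z ∷ []) ≤-refl
      (append (y∉ ∷ z∉ ∷ []) ((y≢z ∷ []) ∷ [] ∷ []))
      λ w₁ w₂ w₃ uniq → let open Around (y ∷ z ∷ w₁ ∷ w₂ ∷ w₃ ∷ []) uniq in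
        forced-sound (# 6) (# 7) (# 8)
          ((# 3 , # 5) ∷ (# 1 , # 5) ∷ (# 2 , # 5) ∷ (# 1 , # 6) ∷
           (# 2 , # 6) ∷ (# 3 , # 6) ∷ (# 1 , # 2) ∷ (# 3 , # 4) ∷ [])
          (extends-▹ {p = # 4} {# 5} {# 3} yz extends-spokes) _

  -- If `z` is a leaf, the claw itself gives `xz` one of the colours `i`, `j`, `k`; otherwise the
  -- search applies.
  xz-avoids′ : ∀ {x a b c i j k l z} → Claw x a b c i j k l → ¬ Edge col l x z
  xz-avoids′ {x} {a} {b} {c} {z = z} claw@record
    { colours = (_ ∷ _ ∷ il ∷ []) ∷ (_ ∷ jl ∷ []) ∷ (kl ∷ []) ∷ _ ; xa = xa ; xb = xb ; xc = xc }
    (x≢z , xz) with z ∈? (x ∷ a ∷ b ∷ c ∷ [])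
  ... | no z∉                                   = xz-avoids claw z∉ xz
  ... | yes (here refl)                         = x≢z refl
  ... | yes (there (here refl))                 = il (trans (sym xa) xz)
  ... | yes (there (there (here refl)))         = jl (trans (sym xb) xz)
  ... | yes (there (there (there (here refl)))) = kl (trans (sym xc) xz)

  az-avoids′ : ∀ {x a b c i j k l z} → Claw x a b c i j k l → ¬ Edge col l a z
  az-avoids′ {x} {a} {b} {c} {z = z} claw (a≢z , az) with z ∈? (x ∷ a ∷ b ∷ c ∷ [])
  ... | no z∉                                   = az-avoids claw z∉ az
  ... | yes (here refl)                         = xz-avoids′ claw (edge-sym (a≢z , az))
  ... | yes (there (here refl))                 = a≢z refl
  ... | yes (there (there (here refl)))         = ab-avoids claw az
  ... | yes (there (there (there (here refl)))) = ab-avoids (swap₂₃ claw) az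

  clawEdge-avoids : ∀ {x a b c i j k l y z} → Claw x a b c i j k l →
                    y ∈ x ∷ a ∷ b ∷ c ∷ [] → ¬ Edge col l y z
  clawEdge-avoids claw (here refl)                         = xz-avoids′ claw
  clawEdge-avoids claw (there (here refl))                 = az-avoids′ claw
  clawEdge-avoids claw (there (there (here refl)))         = az-avoids′ (swap₁₂ claw)
  clawEdge-avoids claw (there (there (there (here refl)))) = az-avoids′ (swap₁₂ (swap₂₃ claw))

  -- Exactness supplies an edge of the fourth colour `l`, which the searches exclude whether or not
  -- it meets the claw.
  noClaw : ∀ {x a b c i j k l} → ¬ Claw x a b c i j k l
  noClaw {x} {a} {b} {c} {l = l} claw with y , z , yz ← exact l
    with y ∈? (x ∷ a ∷ b ∷ c ∷ []) | z ∈? (x ∷ a ∷ b ∷ c ∷ [])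
  ... | yes y∈ | _      = clawEdge-avoids claw y∈ yz
  ... | no  _  | yes z∈ = clawEdge-avoids claw z∈ (edge-sym yz)
  ... | no  y∉ | no  z∉ = yz-avoids claw y∉ z∉ yz

  -- The dominant colour

  Sees : Fin n → Colour → Set
  Sees x i = ∃[ a ] Edge col i x a

  -- Edges of distinct colours at `x` have distinct other ends, so they form a claw.
  noThreeColours : ∀ {x i j k} → Sees x i → Sees x j → Sees x k → i ≢ j → i ≢ k → j ≢ k → ⊥
  noThreeColours (a , x≢a , xa) (b , x≢b , xb) (c , x≢c , xc) i≢j i≢k j≢k =
    noClaw record
      { vertices = (x≢a ∷ x≢b ∷ x≢c ∷ []) ∷ (distinct xa xb i≢j ∷ distinct xa xc i≢k ∷ []) ∷
                   (distinct xb xc j≢k ∷ []) ∷ [] ∷ []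
      ; colours  = proj₂ (complete₃ ((i≢j ∷ i≢k ∷ []) ∷ (j≢k ∷ []) ∷ [] ∷ []))
      ; xa = xa ; xb = xb ; xc = xc }
    where
    distinct : ∀ {x u v i j} → col x u ≡ i → col x v ≡ j → i ≢ j → u ≢ v
    distinct refl refl i≢j refl = i≢j refl

  oneOf : ∀ {x i j u} → Sees x i → Sees x j → i ≢ j → x ≢ u → col x u ≡ i ⊎ col x u ≡ j
  oneOf {x} {i} {j} {u} si sj i≢j x≢u with col x u ≟ᶠ i | col x u ≟ᶠ j
  ... | yes eq | _      = inj₁ eq
  ... | no  _  | yes eq = inj₂ eq
  ... | no ≢i  | no ≢j  = ⊥-elim (noThreeColours si sj (u , x≢u , refl) i≢j (≢i ∘ sym) (≢j ∘ sym))

  -- Let `p` and `q` be ends of edges of colours 0 and 1. If `pq` has colour 0, then `q` sees both;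
  -- otherwise `p` sees 0 and the colour of `pq`.
  bichromaticVertex : ∃[ x ] ∃[ i ] ∃[ j ] i ≢ j × Sees x i × Sees x j
  bichromaticVertex with p , p′ , pp′ ← exact (# 0) | q , q′ , qq′ ← exact (# 1) with p ≟ᶠ q
  ... | yes refl = p , # 0 , # 1 , (λ ()) , (p′ , pp′) , (q′ , qq′)
  ... | no  p≢q with col p q ≟ᶠ # 0
  ... | yes eq = q , # 0 , # 1 , (λ ()) , (p , edge-sym (p≢q , eq)) , (q′ , qq′)
  ... | no neq = p , # 0 , col p q , neq ∘ sym , (p′ , pp′) , (q , p≢q , refl)

  -- Pairwise intersecting pairs of colours form a star or a triangle, and a triangle covers only
  -- three colours. This is the star with centre `d`.
  record Dominance : Set where
    field
      {d j k l} : Colour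
      colours   : Unique (d ∷ j ∷ k ∷ l ∷ [])
      {x y z}   : Fin n
      xd        : Sees x d
      xj        : Sees x j
      yd        : Sees y d
      yk        : Sees y k
      zd        : Sees z d
      zl        : Sees z l

  -- Since `y` sees `i` and `k`, the edge `yz` has one of these colours. Colour `k` is impossible:
  -- `xz` has colour `i` or `j`, so `z` would see a third colour besides `k` and `l`.
  hub : ∀ {x y z i j k l} → Unique (i ∷ j ∷ k ∷ l ∷ []) → Sees x i → Sees x j →
        Edge col i x y → Sees y k → Sees z l → Dominance
  hub {x} {y} {z} colours@((ij ∷ ik ∷ il ∷ []) ∷ (jk ∷ jl ∷ []) ∷ (kl ∷ []) ∷ _) xi xj xy yk zl
    with x ≟ᶠ z | y ≟ᶠ z
  ... | yes refl | _        = ⊥-elim (noThreeColours xi xj zl ij il jl)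
  ... | no  _    | yes refl = ⊥-elim (noThreeColours (x , edge-sym xy) yk zl ik il kl)
  ... | no  x≢z  | no  y≢z  with oneOf (x , edge-sym xy) yk ik y≢z
  ... | inj₁ yz = record { colours = colours ; xd = xi ; xj = xj ; yd = x , edge-sym xy
                         ; yk = yk ; zd = y , edge-sym (y≢z , yz) ; zl = zl }
  ... | inj₂ yz with oneOf xi xj ij x≢z
  ... | inj₁ xz = ⊥-elim (noThreeColours (x , edge-sym (x≢z , xz)) (y , edge-sym (y≢z , yz)) zl
                                         ik il kl)
  ... | inj₂ xz = ⊥-elim (noThreeColours (x , edge-sym (x≢z , xz)) (y , edge-sym (y≢z , yz)) zl
                                         jk jl kl)

  -- The colour of `xy`, where `y` sees a colour missing at `x`, decides which colour of `x` is
  -- dominant.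
  dominance : Dominance
  dominance with x , i , j , i≢j , xi , xj ← bichromaticVertex
    with k , l , colours@((ij ∷ ik ∷ il ∷ []) ∷ (jk ∷ jl ∷ []) ∷ rest) ← complete₂ i≢j
    with y , y′ , yk ← exact k | z , z′ , zl ← exact l
    with x ≟ᶠ y
  ... | yes refl = ⊥-elim (noThreeColours xi xj (y′ , yk) ij ik jk)
  ... | no  x≢y  with oneOf xi xj i≢j x≢y
  ... | inj₁ xy = hub colours xi xj (x≢y , xy) (y′ , yk) (z′ , zl)
  ... | inj₂ xy = hub (((ij ∘ sym) ∷ jk ∷ jl ∷ []) ∷ (ik ∷ il ∷ []) ∷ rest) xj xi
                      (x≢y , xy) (y′ , yk) (z′ , zl)

  -- Classes of vertices and their sizes

  module Classes (dom : Dominance) where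
    open Dominance dom

    d≢j : d ≢ j
    d≢j = All.head (AllPairs.head colours)

    d≢k : d ≢ k
    d≢k = All.head (All.tail (AllPairs.head colours))

    d≢l : d ≢ l
    d≢l = All.head (All.tail (All.tail (AllPairs.head colours)))

    -- A vertex joined to none of `x`, `y`, `z` in colour `d` would see all of `j`, `k`, `l`.
    sees-d : ∀ v → Sees v d
    sees-d v with v ≟ᶠ x | v ≟ᶠ y | v ≟ᶠ z
    ... | yes refl | _        | _        = xd
    ... | no _     | yes refl | _        = yd
    ... | no _     | no _     | yes refl = zd
    ... | no v≢x   | no v≢y   | no v≢z
      with oneOf xd xj d≢j (v≢x ∘ sym) | oneOf yd yk d≢k (v≢y ∘ sym) | oneOf zd zl d≢l (v≢z ∘ sym)
    ... | inj₁ xv | _       | _       = x , edge-sym (v≢x ∘ sym , xv)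
    ... | inj₂ _  | inj₁ yv | _       = y , edge-sym (v≢y ∘ sym , yv)
    ... | inj₂ _  | inj₂ _  | inj₁ zv = z , edge-sym (v≢z ∘ sym , zv)
    ... | inj₂ xv | inj₂ yv | inj₂ zv with (_ ∷ (jk ∷ jl ∷ []) ∷ (kl ∷ []) ∷ _) ← colours =
      ⊥-elim (noThreeColours (x , edge-sym (v≢x ∘ sym , xv)) (y , edge-sym (v≢y ∘ sym , yv))
                             (z , edge-sym (v≢z ∘ sym , zv)) jk jl kl)

    minorEdge? : ∀ v → Dec (∃[ u ] (v ≢ u × d ≢ col v u))
    minorEdge? v = any? λ u → ¬? (v ≟ᶠ u) ×-dec ¬? (d ≟ᶠ col v u)

    -- A vertex all of whose edges have the dominant colour may join any class.
    class : Fin n → Colour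
    class v with minorEdge? v
    ... | yes (u , _) = col v u
    ... | no  _       = j

    class≢d : ∀ v → class v ≢ d
    class≢d v with minorEdge? v
    ... | yes (_ , _ , d≢) = d≢ ∘ sym
    ... | no  _            = d≢j ∘ sym

    -- As `u` sees `d`, all its edges of other colours share one colour, that of the witness chosen
    -- by `class`.
    class-edge : ∀ {u v} → u ≢ v → col u v ≢ d → class u ≡ col u v
    class-edge {u} {v} u≢v ≢d with minorEdge? u
    ... | no  none = ⊥-elim (none (v , u≢v , ≢d ∘ sym))
    ... | yes (w , u≢w , d≢) with col u w ≟ᶠ col u v
    ... | yes eq = eq
    ... | no neq = ⊥-elim (noThreeColours (sees-d u) (w , u≢w , refl) (v , u≢v , refl)
                                          d≢ (≢d ∘ sym) neq)

    sameClass : ∀ {t u v} → u ≢ v → class u ≡ t → Edge col d u v ⊎ Edge col t u v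
    sameClass {u = u} {v} u≢v ut with col u v ≟ᶠ d
    ... | yes eq = inj₁ (u≢v , eq)
    ... | no neq = inj₂ (u≢v , trans (sym (class-edge u≢v neq)) ut)

    -- An edge of another colour would put both its ends into the class of that colour.
    acrossClasses : ∀ {u v} → class u ≢ class v → Edge col d u v
    acrossClasses {u} {v} cu≢cv with col u v ≟ᶠ d
    ... | yes eq = cu≢cv ∘ cong class , eq
    ... | no neq = ⊥-elim (cu≢cv (begin
        class u  ≡⟨ class-edge u≢v neq ⟩
        col u v  ≡⟨ col-sym u v ⟩
        col v u  ≡⟨ class-edge (u≢v ∘ sym) (neq ∘ trans (col-sym u v)) ⟨
        class v  ∎))
      where
      open ≡-Reasoning
      u≢v : u ≢ v
      u≢v = cu≢cv ∘ cong class

    class? : ∀ t v → Dec (class v ≡ t)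
    class? t v = class v ≟ᶠ t

    members : Colour → List (Fin n)
    members t = filter (class? t) (allFin n)

    size : Colour → ℕ
    size t = length (members t)

    ∈-members⁻ : ∀ {t v} → v ∈ members t → class v ≡ t
    ∈-members⁻ {t} = proj₂ ∘ ∈-filter⁻ (class? t) {xs = allFin n}

    ∈-members⁺ : ∀ {t v} → class v ≡ t → v ∈ members t
    ∈-members⁺ {t} = ∈-filter⁺ (class? t) (∈-allFin _)

    members-unique : ∀ t → Unique (members t)
    members-unique t = Unique.filter⁺ (class? t) (Unique.allFin⁺ n)

    members-coloured : ∀ t → AllPairs (λ u v → Edge col d u v ⊎ Edge col t u v) (members t)
    members-coloured t = Unique⇒AllPairs (members-unique t)
      λ u∈ _ u≢v → sameClass u≢v (∈-members⁻ u∈)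

    module _ (t : Colour) where
      open Ramsey (edge? col d) (edge? col t) edge-sym edge-sym (λ (v≢v , _) → v≢v refl)

      -- R(2,6) ≤ 6, with a K₆ of colour `t` excluded.
      dominantEdge : ∀ xs → AllPairs (λ u v → Edge col d u v ⊎ Edge col t u v) xs →
                     6 ≤ length xs → Clique (Edge col d) 2 xs
      dominantEdge xs coloured 6≤ with b⟶⟨2,b⟩ 6 xs coloured 6≤
      ... | inj₁ clique                 = clique
      ... | inj₂ (ys , len , pairs , _) = ⊥-elim (noClique₆ (≤-reflexive (sym len)) pairs)

      -- The edges from a K₅ of colour t to the other members of its class have
      -- the dominant colour, and so has some edge among those members.
      dominantTriangle : 14 ≤ size t → Clique (Edge col d) 3 (members t)
      dominantTriangle 14≤ with 14⟶⟨3,5⟩ (members t) (members-coloured t) 14≤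
      ... | inj₁ clique = clique
      ... | inj₂ ([] , () , _)
      ... | inj₂ (q ∷ qs , len , pairs , qs⊆) = triangle
          (dominantEdge rest (AllPairs.filter⁺ _ (members-coloured t)) (≤-trans (m≤m+n 6 3) 9≤rest))
        where
        rest = members t ∖ (q ∷ qs)
        9≤rest : 9 ≤ length rest
        9≤rest = +-cancelˡ-≤ 5 _ _ (≤-trans 14≤
          (≤-trans (length-∖ (q ∷ qs) (members-unique t))
                   (≤-reflexive (cong (_+ length rest) len))))
        rest⁻ : ∀ {v} → v ∈ rest → v ∈ members t × v ∉ q ∷ qs
        rest⁻ = ∈-filter⁻ _ {xs = members t}
        spoke : ∀ {v} → v ∈ rest → Edge col d q v
        spoke v∈ with v∈members , v∉ ← rest⁻ v∈
          with sameClass (λ { refl → v∉ (here refl) }) (∈-members⁻ (qs⊆ (here refl)))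
        ... | inj₁ qv = qv
        ... | inj₂ qv = ⊥-elim (makePineapple qs (suc-injective len) pairs qv (v∉ ∘ there))
        triangle : Clique (Edge col d) 2 rest → Clique (Edge col d) 3 (members t)
        triangle (ys , len′ , pairs′ , ys⊆) =
          q ∷ ys , cong suc len′ , All.tabulate (spoke ∘ ys⊆) ∷ pairs′ ,
          λ { (here refl) → qs⊆ (here refl) ; (there y∈) → proj₁ (rest⁻ (ys⊆ y∈)) }

    crossing : ∀ {t t′ xs ys} → t ≢ t′ → xs ⊆ members t → ys ⊆ members t′ →
               All (λ u → All (Edge col d u) ys) xs
    crossing t≢t′ xs⊆ ys⊆ = All.tabulate λ u∈ → All.tabulate λ v∈ → acrossClasses λ eq →
      t≢t′ (trans (sym (∈-members⁻ (xs⊆ u∈))) (trans eq (∈-members⁻ (ys⊆ v∈))))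

    -- A K₅ of the dominant colour whose part in class t′ is attached to a
    -- further vertex of class t.
    noDominantClique₅ : ∀ {t t′ t″ a b c} → t ≢ t′ → t ≢ t″ → t′ ≢ t″ →
      Clique (Edge col d) a (members t) → Clique (Edge col d) (suc b) (members t′) →
      Clique (Edge col d) c (members t″) → a < size t → ¬ (b + (c + a) ≡ 4)
    noDominantClique₅ {t} {t′} {t″} tt′ tt″ t′t″
      (xs , refl , xs-pairs , xs⊆) (y ∷ ys , refl , ys-pairs , ys⊆) (zs , refl , zs-pairs , zs⊆)
      a< sum≡
      with members t ∖ xs in eq
    ... | [] = <⇒≱ a< (≤-trans (length-∖ xs (members-unique t))
                          (≤-reflexive (trans (cong (λ ws → length xs + length ws) eq)
                                                 (+-identityʳ _))))
    -- The pendent edge is `yw`, between different classes. The sum 4 counts the clique without `y`.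
    ... | w ∷ _ = makePineapple (ys ++ (zs ++ xs))
        (trans (length-++ ys) (trans (cong (length ys +_) (length-++ zs)) sum≡))
        (AllPairs.++⁺ ys-pairs (AllPairs.++⁺ zs-pairs xs-pairs (crossing (tt″ ∘ sym) zs⊆ xs⊆))
          (All.zipWith (λ (p , q) → All.++⁺ p q)
                       (crossing t′t″ ys⊆ zs⊆ , crossing (tt′ ∘ sym) ys⊆ xs⊆)))
        (acrossClasses λ eq → tt′ (trans (sym wt) (trans (sym eq) (∈-members⁻ (ys⊆ (here refl))))))
        (w∉ ∘ ∈-++⁻ ys)
      where
      w∈ : w ∈ members t × w ∉ xs
      w∈ = ∈-filter⁻ _ {xs = members t} (subst (w ∈_) (sym eq) (here refl))
      wt : class w ≡ t
      wt = ∈-members⁻ (proj₁ w∈)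
      w∉ : ¬ (w ∈ ys ⊎ w ∈ zs ++ xs)
      w∉ (inj₁ w∈ys) = tt′ (trans (sym wt) (∈-members⁻ (ys⊆ (there w∈ys))))
      w∉ (inj₂ w∈zx) with ∈-++⁻ zs w∈zx
      ... | inj₁ w∈zs = tt″ (trans (sym wt) (∈-members⁻ (zs⊆ w∈zs)))
      ... | inj₂ w∈xs = proj₂ w∈ w∈xs

    -- Exactness gives an edge of colour `t`, and its ends lie in class `t`.
    member : ∀ {t} → t ≢ d → Clique (Edge col d) 1 (members t)
    member {t} t≢d with u , v , u≢v , uv ← exact t =
      u ∷ [] , refl , [] ∷ [] ,
      λ { (here refl) → ∈-members⁺ (trans (class-edge u≢v (t≢d ∘ trans (sym uv))) uv) }

    -- The K₅ is a triangle in class `t` plus one vertex from each other class.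
    size<14 : ∀ {t t′ t″} → t′ ≢ d → t″ ≢ d → t ≢ t′ → t ≢ t″ → t′ ≢ t″ → size t < 14
    size<14 {t} t′≢d t″≢d tt′ tt″ t′t″ = ≰⇒> λ 14≤ →
      noDominantClique₅ tt′ tt″ t′t″ (dominantTriangle t 14≤) (member t′≢d) (member t″≢d)
        (≤-trans (m≤m+n 4 10) 14≤) refl

    -- The K₅ is composed as 2 + 2 + 1 over the three classes.
    sizes<6 : ∀ {t t′ t″} → t″ ≢ d → t ≢ t′ → t ≢ t″ → t′ ≢ t″ → 6 ≤ size t → size t′ < 6
    sizes<6 {t} {t′} t″≢d tt′ tt″ t′t″ 6≤t = ≰⇒> λ 6≤t′ →
      noDominantClique₅ tt′ tt″ t′t″
        (dominantEdge t (members t) (members-coloured t) 6≤t)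
        (dominantEdge t′ (members t′) (members-coloured t′) 6≤t′)
        (member t″≢d) (≤-trans (m≤m+n 3 3) 6≤t) refl

    n≤sizes : n ≤ size j + (size k + size l)
    n≤sizes = begin
      n
        ≡⟨ length-tabulate id ⟨
      length (allFin n)
        ≤⟨ length-cover (class? j) kl? {allFin n} (All.universal classified _) ⟩
      size j + length (filter kl? (allFin n))
        ≤⟨ +-monoʳ-≤ (size j) (length-filter-∪ (class? k) (class? l) (allFin n)) ⟩
      size j + (size k + size l) ∎
      where
      open ≤-Reasoning
      kl? = class? k ∪? class? l
      classified : ∀ v → class v ≡ j ⊎ (class v ≡ k ⊎ class v ≡ l)
      classified v with palette-surjective colours (class v)
      ... | zero , eq                 = ⊥-elim (class≢d v (sym eq))
      ... | suc zero , eq             = inj₁ (sym eq)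
      ... | suc (suc zero) , eq       = inj₂ (inj₁ (sym eq))
      ... | suc (suc (suc zero)) , eq = inj₂ (inj₂ (sym eq))

    -- At most one class has more than 5 vertices, and it has at most 13.
    impossible : ⊥
    impossible with (dj ∷ dk ∷ dl ∷ []) ∷ (jk ∷ jl ∷ []) ∷ (kl ∷ []) ∷ _ ← colours
      with j<14 ← s≤s⁻¹ (size<14 (dk ∘ sym) (dl ∘ sym) jk jl kl)
         | k<14 ← s≤s⁻¹ (size<14 (dj ∘ sym) (dl ∘ sym) (jk ∘ sym) kl jl)
         | l<14 ← s≤s⁻¹ (size<14 (dj ∘ sym) (dk ∘ sym) (jl ∘ sym) (kl ∘ sym) jk)
      with 6 ≤? size j | 6 ≤? size k
    ... | yes 6≤j | _ = <⇒≱ 24≤n (≤-trans n≤sizes (+-mono-≤ j<14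
            (+-mono-≤ (s≤s⁻¹ (sizes<6 (dl ∘ sym) jk jl kl 6≤j))
                      (s≤s⁻¹ (sizes<6 (dk ∘ sym) jl jk (kl ∘ sym) 6≤j)))))
    ... | no  6≰j | yes 6≤k = <⇒≱ 24≤n (≤-trans n≤sizes (+-mono-≤ (s≤s⁻¹ (≰⇒> 6≰j))
            (+-mono-≤ k<14 (s≤s⁻¹ (sizes<6 (dj ∘ sym) kl (jk ∘ sym) (jl ∘ sym) 6≤k)))))
    ... | no  6≰j | no 6≰k = <⇒≱ 24≤n (≤-trans n≤sizes (+-mono-≤ (s≤s⁻¹ (≰⇒> 6≰j))
            (+-mono-≤ (s≤s⁻¹ (≰⇒> 6≰k)) l<14)))

  absurdity : ⊥
  absurdity = Classes.impossible dominance

-- Copies of P₅ and of the pineapple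

-- With `pineapple?`, this reduces the upper bound to refuting the absence of both structures.
rainbowPath? : ∀ {n} (col : Fin n → Fin n → Colour) → Dec (RainbowPath col)
rainbowPath? col = any? λ v₁ → any? λ v₂ → any? λ v₃ → any? λ v₄ → any? λ v₅ →
  unique? (v₁ ∷ v₂ ∷ v₃ ∷ v₄ ∷ v₅ ∷ []) ×-dec
  unique? (col v₁ v₂ ∷ col v₂ v₃ ∷ col v₃ v₄ ∷ col v₄ v₅ ∷ [])

pineapple? : ∀ {n} (col : Fin n → Fin n → Colour) → Dec (Pineapple col)
pineapple? col =
  any? λ c → any? λ q → any? λ q₁ → any? λ q₂ → any? λ q₃ → any? λ q₄ → any? λ p →
  allPairs? (edge? col c) (q ∷ q₁ ∷ q₂ ∷ q₃ ∷ q₄ ∷ []) ×-dec edge? col c q p ×-dec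
  All.all? (λ q → ¬? (p ≟ᶠ q)) (q₁ ∷ q₂ ∷ q₃ ∷ q₄ ∷ [])

-- Numbers the four edges of the path, to match them with a list of four colours.
pathEdge : ∀ {u v} → Adj (P 5) u v →
           ∃[ i ] ((u ≡ inject₁ i × v ≡ suc i) ⊎ (u ≡ suc i × v ≡ inject₁ i))
pathEdge {v = suc i} (inj₁ u+1≡v) =
  i , inj₁ (toℕ-injective (trans (suc-injective u+1≡v) (sym (toℕ-inject₁ i))) , refl)
pathEdge {u = suc i} (inj₂ v+1≡u) =
  i , inj₂ (refl , toℕ-injective (trans (suc-injective v+1≡u) (sym (toℕ-inject₁ i))))

module _ {n} (χ : EdgeColoring 4 (K n)) where

  total : Fin n → Fin n → Colour
  total u v with u ≟ᶠ v
  -- A default on the diagonal; `Edge` and `RainbowPath` concern only pairs of distinct vertices.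
  ... | yes _   = zero
  ... | no  u≢v = color χ u v u≢v

  total-color : ∀ {u v} (u≢v : u ≢ v) → color χ u v u≢v ≡ total u v
  total-color {u} {v} u≢v with u ≟ᶠ v
  ... | yes u≡v = ⊥-elim (u≢v u≡v)
  ... | no  _   = refl

  total-sym : ∀ u v → total u v ≡ total v u
  total-sym u v with u ≟ᶠ v
  ... | no u≢v = trans (color-sym χ u v u≢v) (total-color (u≢v ∘ sym))
  ... | yes refl with u ≟ᶠ u
  ...   | yes _   = refl
  ...   | no  u≢u = ⊥-elim (u≢u refl)

  total-exact : ∀ c → ∃[ u ] ∃[ v ] Edge total c u v
  total-exact c with u , v , u≢v , eq ← exact χ c = u , v , u≢v , trans (sym (total-color u≢v)) eq

  rainbowCopy : RainbowPath total → Σ (Copy (P 5) (K n)) (Rainbow χ)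
  rainbowCopy (v₁ , v₂ , v₃ , v₄ , v₅ , vs-unique , cs-unique) = path , rainbow
    where
    vs = v₁ ∷ v₂ ∷ v₃ ∷ v₄ ∷ v₅ ∷ []
    cs = total v₁ v₂ ∷ total v₂ v₃ ∷ total v₃ v₄ ∷ total v₄ v₅ ∷ []

    path : Copy (P 5) (K n)
    path = record
      { vertex    = lookup vs
      ; injective = Unique-lookup vs-unique
      ; edge      = λ {u} e eq →
          adj-irrefl (P 5) {u} (subst (Adj (P 5) u) (sym (Unique-lookup vs-unique eq)) e)
      }

    step : ∀ i → total (lookup vs (inject₁ i)) (lookup vs (suc i)) ≡ lookup cs i
    step zero                   = refl
    step (suc zero)             = refl
    step (suc (suc zero))       = refl
    step (suc (suc (suc zero))) = refl

    located : ∀ {u v} (e : Adj (P 5) u v) → ∃[ i ] (copyColor χ path {u} {v} e ≡ lookup cs i ×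
              ((u ≡ inject₁ i × v ≡ suc i) ⊎ (u ≡ suc i × v ≡ inject₁ i)))
    located {u} {v} e with pathEdge {u} {v} e
    ... | i , inj₁ (refl , refl) =
      i , trans (total-color (edge path {u} {v} e)) (step i) , inj₁ (refl , refl)
    ... | i , inj₂ (refl , refl) =
      i , trans (total-color (edge path {u} {v} e))
                (trans (total-sym (lookup vs u) (lookup vs v)) (step i)) , inj₂ (refl , refl)

    rainbow : Rainbow χ path
    rainbow {u} {v} {x} {y} e e′ same with located {u} {v} e | located {x} {y} e′
    ... | i , eq , ends | i′ , eq′ , ends′
      with refl ← Unique-lookup cs-unique {i} {i′} (trans (sym eq) (trans same eq′))
      with ends | ends′
    ... | inj₁ (refl , refl) | inj₁ (refl , refl) = inj₁ (refl , refl)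
    ... | inj₁ (refl , refl) | inj₂ (refl , refl) = inj₂ (refl , refl)
    ... | inj₂ (refl , refl) | inj₁ (refl , refl) = inj₂ (refl , refl)
    ... | inj₂ (refl , refl) | inj₂ (refl , refl) = inj₁ (refl , refl)

  pineappleCopy : Pineapple total → Σ (Copy (PA 6 5 ≤-refl) (K n)) (Monochromatic χ)
  pineappleCopy (c , q , q₁ , q₂ , q₃ , q₄ , p , clique , qp , p≢) = copy , c , λ {u} {v} e →
      trans (total-color (edge copy {u} {v} e)) (proj₂ (edges {u} {v} e))
    where
    qs = q ∷ q₁ ∷ q₂ ∷ q₃ ∷ q₄ ∷ []
    vs = q ∷ q₁ ∷ q₂ ∷ q₃ ∷ q₄ ∷ p ∷ []

    vs-unique : Unique vs
    vs-unique = AllPairs.++⁺ (AllPairs.map proj₁ clique) ([] ∷ [])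
      (All.map (_∷ []) (proj₁ qp ∷ All.map (_∘ sym) p≢))

    sym-edge : ∀ {u v} → Edge total c u v → Edge total c v u
    sym-edge {u} {v} (u≢v , eq) = u≢v ∘ sym , trans (total-sym v u) eq

    lookup-inject₁ : ∀ i → lookup vs (inject₁ i) ≡ lookup qs i
    lookup-inject₁ zero                         = refl
    lookup-inject₁ (suc zero)                   = refl
    lookup-inject₁ (suc (suc zero))             = refl
    lookup-inject₁ (suc (suc (suc zero)))       = refl
    lookup-inject₁ (suc (suc (suc (suc zero)))) = refl

    lower : (u : Fin 6) → toℕ u < 5 → ∃[ i ] u ≡ inject₁ i
    lower u u<5 = fromℕ< u<5 ,
      toℕ-injective (sym (trans (toℕ-inject₁ (fromℕ< u<5)) (toℕ-fromℕ< u<5)))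

    pendent : (u v : Fin 6) → toℕ u ≡ 0 → 5 ≤ toℕ v → Edge total c (lookup vs u) (lookup vs v)
    pendent u v u≡0 5≤v = subst₂ (λ i j → Edge total c (lookup vs i) (lookup vs j))
      (toℕ-injective {i = # 0} {u} (sym u≡0))
      (toℕ-injective {i = # 5} {v} (≤-antisym 5≤v (s≤s⁻¹ (toℕ<n v)))) qp

    edges : ∀ {u v} → Adj (PA 6 5 ≤-refl) u v → Edge total c (lookup vs u) (lookup vs v)
    edges {u} {v} (inj₁ (u≢v , u<5 , v<5)) with i , refl ← lower u u<5 | j , refl ← lower v v<5 =
      subst₂ (Edge total c) (sym (lookup-inject₁ i)) (sym (lookup-inject₁ j))
        (AllPairs-lookup sym-edge clique (u≢v ∘ cong inject₁))
    edges {u} {v} (inj₂ (inj₁ (u≡0 , 5≤v))) = pendent u v u≡0 5≤v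
    edges {u} {v} (inj₂ (inj₂ (v≡0 , 5≤u))) = sym-edge (pendent v u v≡0 5≤u)

    copy : Copy (PA 6 5 ≤-refl) (K n)
    copy = record
      { vertex    = lookup vs
      ; injective = Unique-lookup vs-unique
      ; edge      = λ {u} {v} e → proj₁ (edges {u} {v} e)
      }

upperBound : GallaiRamseyBound 4 (P 5) (PA 6 5 ≤-refl) 24
upperBound .GallaiRamseyBound.colorable = toWitness {a? = 4 ≤? 24 C 2} _
upperBound .GallaiRamseyBound.unavoidable n 24≤n χ
  with rainbowPath? (total χ) | pineapple? (total χ)
... | yes rainbow  | _             = inj₁ (rainbowCopy χ rainbow)
... | no  _        | yes pineapple = inj₂ (pineappleCopy χ pineapple)
... | no  ¬rainbow | no ¬pineapple = ⊥-elim
  (Structure.absurdity 24≤n (total χ) (total-sym χ) (total-exact χ) ¬rainbow ¬pineapple)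

-- The lower bound

-- Branches on whether `x` is the first clique vertex of the list; if so, the others are among its
-- later neighbours.
cliqueFree : ∀ {n} → (Fin n → Fin n → Bool) → ℕ → List (Fin n) → Bool
cliqueFree adj zero    xs       = false
cliqueFree adj (suc k) []       = true
cliqueFree adj (suc k) (x ∷ xs) =
  cliqueFree adj k (filterᵇ (adj x) xs) ∧ cliqueFree adj (suc k) xs

-- If `f i` is `x`, omitting the index `i` leaves a clique among the neighbours of `x`; otherwise
-- the whole clique lies in the tail.
cliqueFree-sound : ∀ {n} (adj : Fin n → Fin n → Bool) k xs → T (cliqueFree adj k xs) →
  (f : Fin k → Fin n) → Injective _≡_ _≡_ f → (∀ i → f i ∈ xs) →
  ¬ (∀ {i j} → i ≢ j → T (adj (f i) (f j)))
cliqueFree-sound adj (suc k) []       free f f-inj f∈ clique with () ← f∈ zero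
cliqueFree-sound adj (suc k) (x ∷ xs) free f f-inj f∈ clique =
  [ (λ (i , fi≡x) → cliqueFree-sound adj k (filterᵇ (adj x) xs)
      (proj₁ (Equivalence.to T-∧ free))
      (f ∘ punchIn i)
      (punchIn-injective i _ _ ∘ f-inj)
      (λ a → ∈-filter⁺ (T? ∘ adj x)
        (Any.tail (λ eq → punchInᵢ≢i i a (f-inj (trans eq (sym fi≡x)))) (f∈ (punchIn i a)))
        (subst (λ y → T (adj y _)) fi≡x (clique (punchInᵢ≢i i a ∘ sym))))
      (λ a≢b → clique (a≢b ∘ punchIn-injective i _ _)))
  , (λ f≢x → cliqueFree-sound adj (suc k) xs
      (proj₂ (Equivalence.to (T-∧ {cliqueFree adj k (filterᵇ (adj x) xs)}) free))
      f f-inj (λ i → Any.tail (λ eq → f≢x (i , eq)) (f∈ i)) clique)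
  ]′ (toSum (any? λ i → f i ≟ᶠ x))

-- The first block carries the circulant graph C₁₃(1, 5), which has neither a
-- triangle nor an independent set of 5 vertices; colours 2 and 3 form two K₅.
block : Fin 23 → Colour
block u = if toℕ u <ᵇ 13 then # 1 else if toℕ u <ᵇ 18 then # 2 else # 3

-- The differences 8 and 12 are the negatives of 5 and 1 modulo 13.
circulantEdge : Fin 23 → Fin 23 → Bool
circulantEdge u v = any (∣ toℕ u - toℕ v ∣ ≡ᵇ_) (1 ∷ 5 ∷ 8 ∷ 12 ∷ [])

tint : Fin 23 → Fin 23 → Colour
tint u v = if block u == block v
           then (if (block u == # 1) ∧ circulantEdge u v then # 0 else block u)
           else # 0

tint-sym : ∀ u v → tint u v ≡ tint v u
tint-sym = toWitness {a? = all? λ u → all? λ v → tint u v ≟ᶠ tint v u} _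

tint-block : ∀ u v → tint u v ≢ # 0 → block u ≡ tint u v
tint-block = toWitness
  {a? = all? λ u → all? λ v → ¬? (tint u v ≟ᶠ # 0) →-dec (block u ≟ᶠ tint u v)} _

χ₂₃ : EdgeColoring 4 (K 23)
χ₂₃ = record
  { color     = λ u v _ → tint u v
  ; color-sym = λ u v _ → tint-sym u v
  ; exact     = λ { zero                   → # 0  , # 1  , (λ ()) , refl
                  ; (suc zero)             → # 0  , # 2  , (λ ()) , refl
                  ; (suc (suc zero))       → # 13 , # 14 , (λ ()) , refl
                  ; (suc (suc (suc zero))) → # 18 , # 19 , (λ ()) , refl }
  }

-- Edges of distinct colours other than 0 lie in distinct blocks.
adjacentEdges : ∀ u v w → tint u v ≢ tint v w → tint u v ≡ # 0 ⊎ tint v w ≡ # 0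
adjacentEdges u v w distinct with tint u v ≟ᶠ # 0 | tint v w ≟ᶠ # 0
... | yes eq | _      = inj₁ eq
... | no  _  | yes eq = inj₂ eq
... | no ≢0  | no ≢0′ = ⊥-elim (distinct (begin
    tint u v ≡⟨ tint-sym u v ⟩
    tint v u ≡⟨ tint-block v u (≢0 ∘ trans (tint-sym u v)) ⟨
    block v  ≡⟨ tint-block v w ≢0′ ⟩
    tint v w ∎))
  where open ≡-Reasoning

-- The first two edges of the path include one of colour 0, and so do the last two; hence colour 0
-- repeats.
χ₂₃-noRainbow : (f : Copy (P 5) (K 23)) → ¬ Rainbow χ₂₃ f
χ₂₃-noRainbow f rainbow =
  [ (λ 12≡0 → [ clash e₁₂ e₃₄ (λ ()) (λ ()) 12≡0 , clash e₁₂ e₄₅ (λ ()) (λ ()) 12≡0 ]′ second)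
  , (λ 23≡0 → [ clash e₂₃ e₃₄ (λ ()) (λ ()) 23≡0 , clash e₂₃ e₄₅ (λ ()) (λ ()) 23≡0 ]′ second) ]′
  first
  where
  e₁₂ : Adj (P 5) (# 0) (# 1)
  e₁₂ = inj₁ refl
  e₂₃ : Adj (P 5) (# 1) (# 2)
  e₂₃ = inj₁ refl
  e₃₄ : Adj (P 5) (# 2) (# 3)
  e₃₄ = inj₁ refl
  e₄₅ : Adj (P 5) (# 3) (# 4)
  e₄₅ = inj₁ refl

  differ : ∀ {u v x y} (e : Adj (P 5) u v) (e′ : Adj (P 5) x y) → u ≢ x → u ≢ y →
           copyColor χ₂₃ f {u} {v} e ≢ copyColor χ₂₃ f {x} {y} e′
  differ {u} {v} {x} {y} e e′ u≢x u≢y =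
    [ u≢x ∘ proj₁ , u≢y ∘ proj₁ ]′ ∘ rainbow {u} {v} {x} {y} e e′

  clash : ∀ {u v x y} (e : Adj (P 5) u v) (e′ : Adj (P 5) x y) → u ≢ x → u ≢ y →
          copyColor χ₂₃ f {u} {v} e ≡ # 0 → copyColor χ₂₃ f {x} {y} e′ ≢ # 0
  clash {u} {v} {x} {y} e e′ u≢x u≢y eq eq′ =
    differ {u} {v} {x} {y} e e′ u≢x u≢y (trans eq (sym eq′))

  first : tint (vertex f (# 0)) (vertex f (# 1)) ≡ # 0 ⊎
          tint (vertex f (# 1)) (vertex f (# 2)) ≡ # 0
  first = adjacentEdges (vertex f (# 0)) (vertex f (# 1)) (vertex f (# 2))
    (differ {# 0} {# 1} {# 1} {# 2} e₁₂ e₂₃ (λ ()) (λ ()))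

  second : tint (vertex f (# 2)) (vertex f (# 3)) ≡ # 0 ⊎
           tint (vertex f (# 3)) (vertex f (# 4)) ≡ # 0
  second = adjacentEdges (vertex f (# 2)) (vertex f (# 3)) (vertex f (# 4))
    (differ {# 2} {# 3} {# 3} {# 4} e₃₄ e₄₅ (λ ()) (λ ()))

-- A clique of colour 0 has at most 2 + 1 + 1 vertices, and one of colour 1 is an independent set of
-- the circulant graph. A K₅ of colour 2 or 3 fills its block and leaves no room for a pendent
-- vertex.
χ₂₃-noPineapple : (f : Copy (PA 6 5 ≤-refl) (K 23)) → ¬ Monochromatic χ₂₃ f
χ₂₃-noPineapple f (c , mono) = excluded c refl
  where
  clique : ∀ {i j : Fin 5} → i ≢ j → tint (vertex f (inject₁ i)) (vertex f (inject₁ j)) ≡ c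
  clique {i} {j} i≢j = mono {inject₁ i} {inject₁ j}
    (inj₁ ((i≢j ∘ inject₁-injective) , below i , below j))
    where
    below : ∀ i → toℕ (inject₁ {5} i) < 5
    below i = subst (_< 5) (sym (toℕ-inject₁ i)) (toℕ<n i)

  noClique₅ : ∀ t → T (cliqueFree (λ u v → tint u v == t) 5 (allFin 23)) → c ≢ t
  noClique₅ t free refl = cliqueFree-sound (λ u v → tint u v == t) 5 (allFin 23) free
    (vertex f ∘ inject₁) (inject₁-injective ∘ injective f) (λ _ → ∈-allFin _) (==-refl ∘ clique)

  hasNeighbour : ∀ u → ∃[ v ] Adj (PA 6 5 ≤-refl) u v
  hasNeighbour = toWitness {a? = all? λ u → any? λ v → adj? (PA 6 5 ≤-refl) u v} _

  -- Edges of nonzero colour stay inside the block of that colour, and every vertex of the pineapple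
  -- has an edge.
  inBlock : c ≢ # 0 → ∀ u → block (vertex f u) ≡ c
  inBlock c≢0 u with v , e ← hasNeighbour u =
    trans (tint-block (vertex f u) (vertex f v) (c≢0 ∘ trans (sym (mono {u} {v} e))))
          (mono {u} {v} e)

  -- Cliques for this relation are arbitrary sets of vertices of block `t`, so `cliqueFree` bounds
  -- the size of the block.
  within : Colour → Fin 23 → Fin 23 → Bool
  within t u v = (block u == t) ∧ (block v == t)

  noBlock₆ : ∀ t → t ≢ # 0 → T (cliqueFree (within t) 6 (allFin 23)) → c ≢ t
  noBlock₆ t t≢0 free refl = cliqueFree-sound (within t) 6 (allFin 23) free (vertex f) (injective f)
    (λ _ → ∈-allFin _)
    (λ {i} {j} _ → Equivalence.from (T-∧ {block (vertex f i) == t})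
                     (==-refl (inBlock t≢0 i) , ==-refl (inBlock t≢0 j)))

  excluded : ∀ t → c ≢ t
  excluded zero                   = noClique₅ (# 0) _
  excluded (suc zero)             = noClique₅ (# 1) _
  excluded (suc (suc zero))       = noBlock₆ (# 2) (λ ()) _
  excluded (suc (suc (suc zero))) = noBlock₆ (# 3) (λ ()) _

theorem4p3 : gr 4 ⟨ P 5 ∶ PA 6 5 ≤-refl ⟩≡ 24
-- A bound below 24 would apply to `n = 23` and hence to `χ₂₃`.
theorem4p3 = upperBound , λ M bound → ≮⇒≥ λ M<24 →
  [ (λ (f , rainbow) → χ₂₃-noRainbow f rainbow) , (λ (f , mono) → χ₂₃-noPineapple f mono) ]′
    (bound .GallaiRamseyBound.unavoidable 23 (s≤s⁻¹ M<24) χ₂₃)
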